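{- The Dowling polynomials $D_m(n,x)=\sum_{k=0}^n W_m(n,k)x^k$, $n\ge 0$, form the moments for a family of orthogonal polynomials.
   Context: The Whitney numbers of the second kind of Dowling lattices $W_m(n,k)$ are defined by $\sum_{n\ge 0} W_m(n,k)\frac{z^n}{n!}=\frac{e^z}{m^k k!}(e^{mz}-1)^k$; explicitly $W_m(n,k)=\sum_{i=k}^n\binom{n}{i}m^{i-k}S(i,k)$, where $S(i,k)$ are the Stirling numbers of the second kind. When $m=0$ one has $W_0(n,k)=\binom{n}{k}$. Here $m$ is a parameter and $x$ is the variable of the Dowling polynomials; $x$ acts as a parameter for the family of orthogonal polynomials, whose own variable is denoted $z$. Families of orthogonal polynomials and their moments are understood as follows. A family of orthogonal polynomials $(P_n(z))_{n\ge 0}$ is given by a three-term recurrence $P_n(z)=(z-(\alpha+(n-1)\gamma))P_{n-1}(z)-((n-1)\beta+(n-1)(n-2)\delta)P_{n-2}(z)$ with $P_0(z)=1$, $P_1(z)=z-\alpha$, where the coefficients $\alpha,\beta,\gamma,\delta$ do not depend on $n$ or $z$ (they may depend on $m$ and $x$). Its coefficient array is the lower-triangular matrix $(m^*_{n,k})$ with $P_n(z)=\sum_{k=0}^n m^*_{n,k}z^k$, and its moments are the elements of the first column of the inverse matrix $M=(m^*_{n,k})^{ -1}$. -}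

module Defs where

open import Algebra.Bundles using (CommutativeRing)
open import Data.Fin.Base using (toℕ)
open import Data.List.Base using (List; []; _∷_; map)
open import Data.Nat.Base as ℕ using (ℕ; zero; suc; _∸_)
open import Data.Nat.Combinatorics using (_C_)
open import Data.Nat.Properties using (_≟_)
open import Data.Product.Base using (∃; _×_)
open import Level using (_⊔_)
open import Relation.Nullary.Decidable.Core using (yes; no)

-- Stirling numbers of the second kind.
S : ℕ → ℕ → ℕ
S zero    zero    = 1
S zero    (suc k) = 0
S (suc n) zero    = 0
S (suc n) (suc k) = suc k ℕ.* S n (suc k) ℕ.+ S n k

module Moments {c ℓ} (R : CommutativeRing c ℓ) where

  open CommutativeRing R
  open import Algebra.Properties.Semiring.Exp semiring using (_^_)
  open import Algebra.Properties.Semiring.Mult semiring using () renaming (_×_ to _·_)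
  open import Algebra.Properties.Semiring.Sum semiring using (sum-syntax)

  -- Both end points are included; the sum is empty when b < a.
  ∑-interval : ℕ → ℕ → (ℕ → Carrier) → Carrier
  ∑-interval a b f = ∑[ j < suc b ∸ a ] f (a ℕ.+ toℕ j)

  infixr 5 ∑-interval
  syntax ∑-interval a b (λ i → t) = ∑[ i from a to b ] t

  -- The Whitney number W_m(n,k), i.e. the coefficient of zⁿ/n! in
  -- e^z (e^{mz} - 1)^k / (m^k k!).  This explicit form inverts nothing in R and
  -- covers m = 0, where it gives n C k.
  W : Carrier → ℕ → ℕ → Carrier
  W m n k = ∑[ i from k to n ] ((n C i) ℕ.* S i k) · (m ^ (i ∸ k))

  D : Carrier → ℕ → Carrier → Carrier
  D m n x = ∑[ k from 0 to n ] W m n k * x ^ k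

  -- Polynomials in z, as lists of coefficients in order of increasing degree;
  -- trailing zeros are allowed.
  Poly : Set c
  Poly = List Carrier

  coeff : Poly → ℕ → Carrier
  coeff []      _       = 0#
  coeff (a ∷ p) zero    = a
  coeff (a ∷ p) (suc k) = coeff p k

  infixl 6 _+ₚ_ _-ₚ_
  infixl 7 _*ₚ_

  _+ₚ_ : Poly → Poly → Poly
  []      +ₚ q       = q
  (a ∷ p) +ₚ []      = a ∷ p
  (a ∷ p) +ₚ (b ∷ q) = (a + b) ∷ (p +ₚ q)

  _-ₚ_ : Poly → Poly → Poly
  p -ₚ q = p +ₚ map -_ q

  _*ₚ_ : Poly → Poly → Poly
  []      *ₚ q = []
  (a ∷ p) *ₚ q = map (a *_) q +ₚ (0# ∷ (p *ₚ q))

  const : Carrier → Poly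
  const a = a ∷ []

  z : Poly
  z = 0# ∷ 1# ∷ []

  -- The last clause is the three-term recurrence at index n = i + 2.
  orthogonal : (α β γ δ : Carrier) → ℕ → Poly
  orthogonal α β γ δ zero          = const 1#
  orthogonal α β γ δ (suc zero)    = z -ₚ const α
  orthogonal α β γ δ (suc (suc i)) =
       (z -ₚ const (α + suc i · γ)) *ₚ orthogonal α β γ δ (suc i)
    -ₚ const (suc i · β + (suc i ℕ.* i) · δ) *ₚ orthogonal α β γ δ i

  Matrix : Set c
  Matrix = ℕ → ℕ → Carrier

  coefficientArray : (ℕ → Poly) → Matrix
  coefficientArray P n k = coeff (P n) k

  LowerTriangular : Matrix → Set ℓ
  LowerTriangular A = ∀ n k → n ℕ.< k → A n k ≈ 0#

  identity : Matrix
  identity n k with n ≟ k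
  ... | yes _ = 1#
  ... | no  _ = 0#

  -- The matrix product, for infinite A and B with A lower triangular: row n of
  -- A vanishes beyond column n.
  _⊗_ : Matrix → Matrix → Matrix
  (A ⊗ B) n k = ∑[ j from 0 to n ] A n j * B j k

  record IsInverse (A B : Matrix) : Set ℓ where
    field
      lowerˡ   : LowerTriangular A
      lowerʳ   : LowerTriangular B
      inverseʳ : ∀ n k → (A ⊗ B) n k ≈ identity n k
      inverseˡ : ∀ n k → (B ⊗ A) n k ≈ identity n k

  AreMomentsOf : (ℕ → Carrier) → (ℕ → Poly) → Set (c ⊔ ℓ)
  AreMomentsOf μ P =
    ∃ λ M → IsInverse (coefficientArray P) M × (∀ n → μ n ≈ M n 0)

-- The Dowling polynomials form moments of Charlier type, formally those of
-- 1 + m·N with N Poisson of parameter x/m, so the recurrence coefficients are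
-- α = 1 + x, γ = m, β = m x and δ = 0.  The inverse M of the coefficient array
-- is generated row by row from the tridiagonal production matrix of the family.
-- It factors as the Whitney matrix times the matrix (j C k) x^(j-k), whose first
-- column is x^j, and so the first column of M consists of the Dowling
-- polynomials.  The Whitney matrix is in turn Pascal's triangle times the matrix
-- S(i,k) m^(i-k).  Each factorization follows by moving the production matrix of
-- the left factor across the sum (a discrete Green's identity).

module Submission where

open import Defs
open import Algebra.Bundles using (CommutativeRing)
open import Data.Empty using (⊥-elim)
open import Data.Fin.Base using (toℕ)
open import Data.List.Base using ([]; _∷_; map)
open import Data.Nat.Base as ℕ using (ℕ; zero; suc; _∸_; _<_; z≤n; s≤s)
open import Data.Nat.Combinatorics using (_C_; nCk+nC[k+1]≡[n+1]C[k+1]; k>n⇒nCk≡0)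
import Data.Nat.Properties as ℕₚ
open import Data.Product.Base using (∃; _×_; _,_; proj₁; proj₂)
open import Function.Base using (_∘_)
open import Relation.Binary.PropositionalEquality as ≡ using (_≡_)
open import Relation.Nullary.Decidable.Core using (yes; no)

S-vanishes : ∀ i k → i < k → S i k ≡ 0
S-vanishes zero    (suc k) _         = ≡.refl
S-vanishes (suc i) (suc k) (s≤s i<k)
  rewrite S-vanishes i k i<k | S-vanishes i (suc k) (ℕₚ.m<n⇒m<1+n i<k) | ℕₚ.*-zeroʳ k = ≡.refl

module Production {c ℓ} (R : CommutativeRing c ℓ) where

  open CommutativeRing R
  open Moments R
  open import Algebra.Properties.Semiring.Exp semiring using (_^_; ^-congʳ)
  open import Algebra.Properties.Semiring.Mult semiring
    using (×-congʳ; ×-congˡ; ×-homo-+; ×-assocˡ; ×-assoc-*; ×-comm-*) renaming (_×_ to _·_)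
  open import Algebra.Properties.Semiring.Sum semiring using (sum-syntax; sum-cong-≋)
  open import Algebra.Properties.Ring ring using (-0#≈0#)
  open import Algebra.Properties.AbelianGroup +-abelianGroup using (∙-cancelʳ)
  open import Algebra.Solver.Ring.NaturalCoefficients.Default commutativeSemiring
    using (solve; _:=_; _:+_; _:*_; con)
  open import Relation.Binary.Reasoning.Setoid setoid

  -- Finite sums over initial segments.

  ∑< : ℕ → (ℕ → Carrier) → Carrier
  ∑< n f = ∑[ j < n ] f (toℕ j)

  ∑<-cong : ∀ n {f g} → (∀ j → f j ≈ g j) → ∑< n f ≈ ∑< n g
  ∑<-cong n f≈g = sum-cong-≋ {n} (f≈g ∘ toℕ)

  ∑<-last : ∀ n f → ∑< (suc n) f ≈ ∑< n f + f n
  ∑<-last zero    f = +-comm (f 0) 0#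
  ∑<-last (suc n) f = trans (+-congˡ (∑<-last n (f ∘ suc))) (sym (+-assoc _ _ _))

  -- Whitney numbers are sums starting at `k`, matrix products are sums starting at 0; this converts
  -- one into the other.
  ∑<-drop : ∀ k n f → (∀ j → j < k → f j ≈ 0#) → ∑< (n ∸ k) (λ j → f (k ℕ.+ j)) ≈ ∑< n f
  ∑<-drop zero    n       f f≈0 = refl
  ∑<-drop (suc k) zero    f f≈0 = refl
  ∑<-drop (suc k) (suc n) f f≈0 = begin
    ∑< (n ∸ k) (λ j → f (suc k ℕ.+ j))  ≈⟨ ∑<-drop k n (f ∘ suc) (λ j j<k → f≈0 (suc j) (s≤s j<k)) ⟩
    ∑< n (f ∘ suc)                      ≈⟨ +-identityˡ _ ⟨
    0# + ∑< n (f ∘ suc)                 ≈⟨ +-congʳ (f≈0 0 (s≤s z≤n)) ⟨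
    f 0 + ∑< n (f ∘ suc)                ∎

  -- Tridiagonal matrices acting on rows and on columns.

  -- The value 0 at index 0 stands for the absent entry of index -1, so the tridiagonal formulas
  -- keep one shape at the border.
  prev : (ℕ → Carrier) → ℕ → Carrier
  prev u zero    = 0#
  prev u (suc k) = u k

  prev-cong : ∀ {u v} → (∀ k → u k ≈ v k) → ∀ k → prev u k ≈ prev v k
  prev-cong u≈v zero    = refl
  prev-cong u≈v (suc k) = u≈v k

  column : Matrix → ℕ → ℕ → Carrier
  column A k n = A n k

  -- The row vector u multiplied by the tridiagonal matrix with diagonal p,
  -- superdiagonal 1 and subdiagonal entries q 1, q 2, …
  step : (p q u : ℕ → Carrier) → ℕ → Carrier
  step p q u k = prev u k + p k * u k + q (suc k) * u (suc k)

  -- The same matrix applied to the column vector v.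
  costep : (p q v : ℕ → Carrier) → ℕ → Carrier
  costep p q v n = v (suc n) + p n * v n + q n * prev v n

  step-cong : ∀ p q {u v} → (∀ k → u k ≈ v k) → ∀ k → step p q u k ≈ step p q v k
  step-cong p q u≈v k =
    +-cong (+-cong (prev-cong u≈v k) (*-congˡ (u≈v k))) (*-congˡ (u≈v (suc k)))

  step-zero : ∀ p q k → step p q (λ _ → 0#) k ≈ 0#
  step-zero p q zero    = solve 2 (λ a b → con 0 :+ a :* con 0 :+ b :* con 0 := con 0) refl (p 0) (q 1)
  step-zero p q (suc k) =
    solve 2 (λ a b → con 0 :+ a :* con 0 :+ b :* con 0 := con 0) refl (p (suc k)) (q (suc (suc k)))

  step-linear : ∀ p q a u v k →
    step p q (λ i → a * u i + v i) k ≈ a * step p q u k + step p q v k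
  step-linear p q a u v zero =
    solve 7 (λ a p q u u′ v v′ →
        con 0 :+ p :* (a :* u :+ v) :+ q :* (a :* u′ :+ v′)
      := a :* (con 0 :+ p :* u :+ q :* u′) :+ (con 0 :+ p :* v :+ q :* v′))
      refl a (p 0) (q 1) (u 0) (u 1) (v 0) (v 1)
  step-linear p q a u v (suc k) =
    solve 9 (λ a p q u₀ u u′ v₀ v v′ →
        (a :* u₀ :+ v₀) :+ p :* (a :* u :+ v) :+ q :* (a :* u′ :+ v′)
      := a :* (u₀ :+ p :* u :+ q :* u′) :+ (v₀ :+ p :* v :+ q :* v′))
      refl a (p (suc k)) (q (suc (suc k)))
        (u k) (u (suc k)) (u (suc (suc k))) (v k) (v (suc k)) (v (suc (suc k)))

  -- Associativity `a (B T) = (a B) T`, where T is the tridiagonal matrix of `p` and `q`; linearity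
  -- peels off one row of `B` at a time.
  ∑<-step : ∀ p q n (a : ℕ → Carrier) (B : Matrix) k →
    ∑< n (λ j → a j * step p q (B j) k) ≈ step p q (λ i → ∑< n (λ j → a j * B j i)) k
  ∑<-step p q zero    a B k = sym (step-zero p q k)
  ∑<-step p q (suc n) a B k =
    trans (+-congˡ (∑<-step p q n (a ∘ suc) (B ∘ suc) k)) (sym (step-linear p q (a 0) (B 0) _ k))

  -- Both sums are truncations of `u T v`, bracketed as `(u T) v` and as `u (T v)`. The boundary
  -- terms are the two products that T forms between the indices `n - 1` and `n`.
  green : ∀ p q u v n →
      ∑< n (λ j → step p q u j * v j) + prev u n * v n
    ≈ ∑< n (λ j → u j * costep p q v j) + q n * u n * prev v n
  green p q u v zero =
    solve 3 (λ q u v → con 0 :+ con 0 :* v := con 0 :+ q :* u :* con 0) refl (q 0) (u 0) (v 0)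
  green p q u v (suc n) = begin
    ∑< (suc n) f + u n * v (suc n)
      ≈⟨ +-congʳ (∑<-last n f) ⟩
    ∑< n f + step p q u n * v n + u n * v (suc n)
      ≈⟨ solve 8 (λ s u₀ u u′ v v′ p q →
             s :+ (u₀ :+ p :* u :+ q :* u′) :* v :+ u :* v′
           := s :+ u₀ :* v :+ ((p :* u :+ q :* u′) :* v :+ u :* v′))
         refl (∑< n f) (prev u n) (u n) (u (suc n)) (v n) (v (suc n)) (p n) (q (suc n)) ⟩
    ∑< n f + prev u n * v n + rest
      ≈⟨ +-congʳ (green p q u v n) ⟩
    ∑< n g + q n * u n * prev v n + rest
      ≈⟨ solve 9 (λ s v₀ u u′ v v′ p q q′ →
             s :+ q :* u :* v₀ :+ ((p :* u :+ q′ :* u′) :* v :+ u :* v′)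
           := s :+ u :* (v′ :+ p :* v :+ q :* v₀) :+ q′ :* u′ :* v)
         refl (∑< n g) (prev v n) (u n) (u (suc n)) (v n) (v (suc n)) (p n) (q n) (q (suc n)) ⟩
    ∑< n g + u n * costep p q v n + q (suc n) * u (suc n) * v n
      ≈⟨ +-congʳ (∑<-last n g) ⟨
    ∑< (suc n) g + q (suc n) * u (suc n) * v n ∎
    where
    f = λ j → step p q u j * v j
    g = λ j → u j * costep p q v j
    rest = (p n * u n + q (suc n) * u (suc n)) * v n + u n * v (suc n)

  -- If `u` lives on `0..n`, then `u T` lives on `0..n+1`, hence the two lengths. At the cut `n + 2`
  -- both boundary terms contain an entry of `u` beyond `n`.
  green-finite : ∀ p q u v n → (∀ j → n < j → u j ≈ 0#) →
    ∑< (suc (suc n)) (λ j → step p q u j * v j) ≈ ∑< (suc n) (λ j → u j * costep p q v j)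
  green-finite p q u v n u≈0 = begin
    ∑< N f                                  ≈⟨ +-identityʳ _ ⟨
    ∑< N f + 0#                             ≈⟨ +-congˡ (zeroˡ (v N)) ⟨
    ∑< N f + 0# * v N                       ≈⟨ +-congˡ (*-congʳ u₁≈0) ⟨
    ∑< N f + prev u N * v N                 ≈⟨ green p q u v N ⟩
    ∑< N g + q N * u N * prev v N           ≈⟨ +-cong (∑<-last (suc n) g) (*-congʳ (*-congˡ u₂≈0)) ⟩
    ∑< (suc n) g + u (suc n) * costep p q v (suc n) + q N * 0# * prev v N
                                            ≈⟨ +-congʳ (+-congˡ (*-congʳ u₁≈0)) ⟩
    ∑< (suc n) g + 0# * costep p q v (suc n) + q N * 0# * prev v N
      ≈⟨ solve 4 (λ s a b c → s :+ con 0 :* a :+ b :* con 0 :* c := s)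
           refl (∑< (suc n) g) (costep p q v (suc n)) (q N) (prev v N) ⟩
    ∑< (suc n) g                            ∎
    where
    N = suc (suc n)
    f = λ j → step p q u j * v j
    g = λ j → u j * costep p q v j
    u₁≈0 = u≈0 (suc n) ℕₚ.≤-refl
    u₂≈0 = u≈0 N (ℕₚ.n≤1+n _)

  -- Arrays generated by a production matrix.

  -- Row `n` is `e_0 T^n`, so T is the production (Stieltjes) matrix. Entry `(n, k)` is the weighted
  -- count of Motzkin paths of length `n` from height 0 to height `k`.
  produced : (p q : ℕ → Carrier) → Matrix
  produced p q zero    = identity 0
  produced p q (suc n) = step p q (produced p q n)

  produced-unique : ∀ p q (U : Matrix) → (∀ k → U 0 k ≈ identity 0 k) →
    (∀ n k → U (suc n) k ≈ step p q (U n) k) → ∀ n k → U n k ≈ produced p q n k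
  produced-unique p q U base next zero    k = base k
  produced-unique p q U base next (suc n) k =
    trans (next n k) (step-cong p q (produced-unique p q U base next n) k)

  produced-lowerTriangular : ∀ p q → LowerTriangular (produced p q)
  produced-lowerTriangular p q zero    (suc k) _         = refl
  produced-lowerTriangular p q (suc n) (suc k) (s≤s n<k) = begin
    M n k + p (suc k) * M n (suc k) + q (suc (suc k)) * M n (suc (suc k))
      ≈⟨ +-cong (+-cong (low k n<k) (*-congˡ (low (suc k) n<1+k)))
                (*-congˡ (low (suc (suc k)) (ℕₚ.m<n⇒m<1+n n<1+k))) ⟩
    0# + p (suc k) * 0# + q (suc (suc k)) * 0#
      ≈⟨ solve 2 (λ a b → con 0 :+ a :* con 0 :+ b :* con 0 := con 0) refl _ _ ⟩
    0# ∎
    where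
    M = produced p q
    low = produced-lowerTriangular p q n
    n<1+k = ℕₚ.m<n⇒m<1+n n<k

  -- If `T V = V T′` and row 0 of `V` is `e_0`, then `e_0 T^n V = e_0 V T′^n = e_0 T′^n`. The Green
  -- identity moves T from the left factor to `V`.
  produced-⊗ : ∀ p q p′ q′ (V : Matrix) → (∀ k → V 0 k ≈ identity 0 k) →
    (∀ j k → costep p q (column V k) j ≈ step p′ q′ (V j) k) →
    ∀ n k → (produced p q ⊗ V) n k ≈ produced p′ q′ n k
  produced-⊗ p q p′ q′ V base commutes = produced-unique p′ q′ (U ⊗ V) base′ next
    where
    U = produced p q
    base′ : ∀ k → (U ⊗ V) 0 k ≈ identity 0 k
    base′ k = trans (+-identityʳ _) (trans (*-identityˡ _) (base k))
    next : ∀ n k → (U ⊗ V) (suc n) k ≈ step p′ q′ ((U ⊗ V) n) k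
    next n k = begin
      ∑< (suc (suc n)) (λ j → step p q (U n) j * V j k)
        ≈⟨ green-finite p q (U n) (column V k) n (produced-lowerTriangular p q n) ⟩
      ∑< (suc n) (λ j → U n j * costep p q (column V k) j)
        ≈⟨ ∑<-cong (suc n) (λ j → *-congˡ {U n j} (commutes j k)) ⟩
      ∑< (suc n) (λ j → U n j * step p′ q′ (V j) k)
        ≈⟨ ∑<-step p′ q′ (suc n) (U n) V k ⟩
      step p′ q′ ((U ⊗ V) n) k ∎

  ⊗-congʳ : ∀ (B : Matrix) {A A′ : Matrix} → (∀ n k → A n k ≈ A′ n k) →
    ∀ n k → (A ⊗ B) n k ≈ (A′ ⊗ B) n k
  ⊗-congʳ B A≈A′ n k = ∑<-cong (suc n) (λ j → *-congʳ {B j k} (A≈A′ n j))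

  -- The identity matrix.

  identity-suc : ∀ n k → identity (suc n) (suc k) ≈ identity n k
  identity-suc n k with suc n ℕₚ.≟ suc k | n ℕₚ.≟ k
  ... | yes _   | yes _   = refl
  ... | yes s≡s | no  n≢k = ⊥-elim (n≢k (ℕₚ.suc-injective s≡s))
  ... | no  s≢s | yes n≡k = ⊥-elim (s≢s (≡.cong suc n≡k))
  ... | no  _   | no  _   = refl

  identity-next : ∀ n k → identity (suc n) k ≈ prev (identity n) k
  identity-next n zero    = refl
  identity-next n (suc k) = identity-suc n k

  identity-diagonal : ∀ (f : ℕ → Carrier) n k → f n * identity n k ≈ f k * identity n k
  identity-diagonal f n k with n ℕₚ.≟ k
  ... | yes ≡.refl = refl
  ... | no  _      = trans (zeroʳ _) (sym (zeroʳ _))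

  -- Both sides are the entry `(n, k)` of T, read off column `k` on the left and row `n` on the
  -- right.
  identity-commutes : ∀ p q n k → costep p q (column identity k) n ≈ step p q (identity n) k
  identity-commutes p q n k =
    +-cong (+-cong (identity-next n k) (identity-diagonal p n k)) (offDiagonal n)
    where
    offDiagonal : ∀ n → q n * prev (column identity k) n ≈ q (suc k) * identity n (suc k)
    offDiagonal zero    = trans (zeroʳ _) (sym (zeroʳ _))
    offDiagonal (suc n) =
      trans (identity-diagonal (q ∘ suc) n k) (*-congˡ (sym (identity-suc n k)))

  step-00 : ∀ u k → step (λ _ → 0#) (λ _ → 0#) u k ≈ prev u k
  step-00 u k =
    solve 3 (λ a b c → a :+ con 0 :* b :+ con 0 :* c := a) refl (prev u k) (u k) (u (suc k))

  -- With `p = q = 0` the production matrix is the shift, which sends `e_n` to `e_(n+1)`.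
  identity-produced : ∀ n k → identity n k ≈ produced (λ _ → 0#) (λ _ → 0#) n k
  identity-produced = produced-unique _ _ identity (λ _ → refl)
    (λ n k → trans (identity-next n k) (sym (step-00 (identity n) k)))

  -- Inverting an array whose rows obey a three-term recurrence.

  module Inverse (p q : ℕ → Carrier) (A : Matrix)
    (base : ∀ k → A 0 k ≈ identity 0 k)
    -- In matrix form `T A = A Z` with Z the shift; for polynomials,
    -- `z P_n = P_(n+1) + p_n P_n + q_n P_(n-1)`.
    (recurrence : ∀ n k → costep p q (column A k) n ≈ prev (A n) k) where

    private M = produced p q

    -- The superdiagonal of T consists of ones, so the value at `n + 1` is isolated by subtraction,
    -- without division.
    costep-cancel : ∀ {u v} n → u n ≈ v n → prev u n ≈ prev v n →
      costep p q u n ≈ costep p q v n → u (suc n) ≈ v (suc n)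
    costep-cancel {u} {v} n eq eq₀ e =
      ∙-cancelʳ (p n * u n) _ _ (∙-cancelʳ (q n * prev u n) _ _
        (trans e (+-cong (+-congˡ (*-congˡ (sym eq))) (*-congˡ (sym eq₀)))))

    -- The recurrence has order two, hence the induction over consecutive pairs.
    costep-unique : ∀ {u v} → u 0 ≈ v 0 → ∀ n →
      (∀ i → i < n → costep p q u i ≈ costep p q v i) →
      u n ≈ v n × prev u n ≈ prev v n
    costep-unique u₀≈v₀ zero    _ = u₀≈v₀ , refl
    costep-unique {u} {v} u₀≈v₀ (suc n) h =
      let (eq , eq₀) = costep-unique {u} {v} u₀≈v₀ n (λ i i<n → h i (ℕₚ.m<n⇒m<1+n i<n))
      in costep-cancel {u} {v} n eq eq₀ (h n ℕₚ.≤-refl) , eq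

    costep-zero : ∀ n → costep p q (λ _ → 0#) n ≈ 0#
    costep-zero zero    = solve 2 (λ a b → con 0 :+ a :* con 0 :+ b :* con 0 := con 0) refl _ _
    costep-zero (suc n) = solve 2 (λ a b → con 0 :+ a :* con 0 :+ b :* con 0 := con 0) refl _ _

    -- Induction on the column: where column `k` vanishes, column `k + 1` solves the homogeneous
    -- recurrence, and its initial value is 0, so it agrees with the zero solution.
    lowerTriangular : LowerTriangular A
    lowerTriangular n (suc k) (s≤s n≤k) =
      proj₁ (costep-unique {column A (suc k)} {λ _ → 0#} (base (suc k)) n (λ i i<n →
        trans (recurrence i (suc k))
          (trans (lowerTriangular i k (ℕₚ.<-≤-trans i<n n≤k)) (sym (costep-zero i)))))

    -- Since `T A = A Z`, `produced-⊗` turns `M A` into the array produced by the shift Z, which is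
    -- the identity.
    M⊗A : ∀ n k → (M ⊗ A) n k ≈ identity n k
    M⊗A n k = trans
      (produced-⊗ p q _ _ A base (λ j k → trans (recurrence j k) (sym (step-00 (A j) k))) n k)
      (sym (identity-produced n k))

    -- Rows `n - 1`, `n` and `n + 1` of a product are sums of different lengths; padding with zeros
    -- lets the recurrence be summed termwise.
    ⊗-extend : ∀ d (B : Matrix) n k → ∑< (d ℕ.+ suc n) (λ j → A n j * B j k) ≈ (A ⊗ B) n k
    ⊗-extend zero    B n k = refl
    ⊗-extend (suc d) B n k = begin
      ∑< (suc N) f                ≈⟨ ∑<-last N f ⟩
      ∑< N f + A n N * B N k      ≈⟨ +-cong (⊗-extend d B n k)
                                            (*-congʳ (lowerTriangular n N (ℕₚ.m≤n+m (suc n) d))) ⟩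
      (A ⊗ B) n k + 0# * B N k    ≈⟨ +-congˡ (zeroˡ _) ⟩
      (A ⊗ B) n k + 0#            ≈⟨ +-identityʳ _ ⟩
      (A ⊗ B) n k                 ∎
      where
      N = d ℕ.+ suc n
      f = λ j → A n j * B j k

    ∑<-costep : ∀ N a b (u v w y : ℕ → Carrier) →
        ∑< N (λ j → (u j + a * v j + b * w j) * y j)
      ≈ ∑< N (λ j → u j * y j) + a * ∑< N (λ j → v j * y j) + b * ∑< N (λ j → w j * y j)
    ∑<-costep zero    a b u v w y =
      solve 2 (λ a b → con 0 := con 0 :+ a :* con 0 :+ b :* con 0) refl a b
    ∑<-costep (suc N) a b u v w y = trans
      (+-congˡ (∑<-costep N a b (u ∘ suc) (v ∘ suc) (w ∘ suc) (y ∘ suc)))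
      (solve 9 (λ a b u v w y s t r →
           (u :+ a :* v :+ b :* w) :* y :+ (s :+ a :* t :+ b :* r)
         := (u :* y :+ s) :+ a :* (v :* y :+ t) :+ b :* (w :* y :+ r))
         refl a b (u 0) (v 0) (w 0) (y 0) _ _ _)

    -- `T A M = A Z M = A M T`: the second equality is the definition of `M`, whose row `j + 1` is
    -- row `j` times T.
    A⊗M-commutes : ∀ n k → costep p q (column (A ⊗ M) k) n ≈ step p q ((A ⊗ M) n) k
    A⊗M-commutes n k = begin
      (A ⊗ M) (suc n) k + p n * (A ⊗ M) n k + q n * prev (column (A ⊗ M) k) n
        ≈⟨ +-cong (+-congˡ (*-congˡ (⊗-extend 1 M n k))) (*-congˡ (extend-prev n)) ⟨
      ∑< N (λ j → A (suc n) j * M j k) + p n * ∑< N (λ j → A n j * M j k)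
        + q n * ∑< N (λ j → prev (column A j) n * M j k)
        ≈⟨ ∑<-costep N (p n) (q n) (A (suc n)) (A n) (λ j → prev (column A j) n) (column M k) ⟨
      ∑< N (λ j → costep p q (column A j) n * M j k)
        ≈⟨ ∑<-cong N (λ j → *-congʳ {M j k} (recurrence n j)) ⟩
      ∑< N (λ j → prev (A n) j * M j k)
        -- The term at `j = 0` vanishes; reindexing turns `M (suc j)` into the step of `M j`.
        ≈⟨ trans (+-congʳ (zeroˡ _)) (+-identityˡ _) ⟩
      ∑< (suc n) (λ j → A n j * step p q (M j) k)
        ≈⟨ ∑<-step p q (suc n) (A n) M k ⟩
      step p q ((A ⊗ M) n) k ∎
      where
      N = suc (suc n)
      ∑<-zero : ∀ N (y : ℕ → Carrier) → ∑< N (λ j → 0# * y j) ≈ 0#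
      ∑<-zero zero    y = refl
      ∑<-zero (suc N) y = trans (+-cong (zeroˡ _) (∑<-zero N (y ∘ suc))) (+-identityˡ _)
      extend-prev : ∀ n → ∑< (suc (suc n)) (λ j → prev (column A j) n * M j k)
                        ≈ prev (column (A ⊗ M) k) n
      extend-prev zero    = ∑<-zero 2 (column M k)
      extend-prev (suc n) = ⊗-extend 2 M n k

    -- `A M` and the identity share row 0 and both commute with T. Commutation determines row
    -- `n + 1` from rows `n` and `n - 1`, so the second component carries the preceding row.
    A⊗M-rows : ∀ n → (∀ k → (A ⊗ M) n k ≈ identity n k)
                   × (∀ k → prev (column (A ⊗ M) k) n ≈ prev (column identity k) n)
    A⊗M-rows zero = (λ k → trans (+-identityʳ _) (base′ k)) , λ _ → refl
      where
      base′ : ∀ k → A 0 0 * M 0 k ≈ identity 0 k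
      base′ k = trans (*-congʳ (base 0)) (*-identityˡ _)
    A⊗M-rows (suc n) = (λ k → costep-cancel {column (A ⊗ M) k} {column identity k} n (row k) (row₀ k) (begin
        costep p q (column (A ⊗ M) k) n  ≈⟨ A⊗M-commutes n k ⟩
        step p q ((A ⊗ M) n) k           ≈⟨ step-cong p q row k ⟩
        step p q (identity n) k          ≈⟨ identity-commutes p q n k ⟨
        costep p q (column identity k) n ∎)) , row
      where
      row = proj₁ (A⊗M-rows n)
      row₀ = proj₂ (A⊗M-rows n)

    isInverse : IsInverse A M
    isInverse = record
      { lowerˡ   = lowerTriangular
      ; lowerʳ   = produced-lowerTriangular p q
      ; inverseʳ = λ n → proj₁ (A⊗M-rows n)
      ; inverseˡ = M⊗A
      }

  -- Coefficients of the orthogonal polynomials.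

  coeff-+ : ∀ f g k → coeff (f +ₚ g) k ≈ coeff f k + coeff g k
  coeff-+ []      g       k       = sym (+-identityˡ _)
  coeff-+ (a ∷ f) []      k       = sym (+-identityʳ _)
  coeff-+ (a ∷ f) (b ∷ g) zero    = refl
  coeff-+ (a ∷ f) (b ∷ g) (suc k) = coeff-+ f g k

  coeff-map : ∀ {h : Carrier → Carrier} → h 0# ≈ 0# → ∀ f k → coeff (map h f) k ≈ h (coeff f k)
  coeff-map h0 []      k       = sym h0
  coeff-map h0 (a ∷ f) zero    = refl
  coeff-map h0 (a ∷ f) (suc k) = coeff-map h0 f k

  coeff-0∷[] : ∀ k → coeff (0# ∷ []) k ≈ 0#
  coeff-0∷[] zero    = refl
  coeff-0∷[] (suc k) = refl

  coeff-∷ : ∀ f k → coeff (0# ∷ f) k ≈ prev (coeff f) k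
  coeff-∷ f zero    = refl
  coeff-∷ f (suc k) = refl

  coeff-const-* : ∀ a f k → coeff (const a *ₚ f) k ≈ a * coeff f k
  coeff-const-* a f k = begin
    coeff (map (a *_) f +ₚ (0# ∷ [])) k         ≈⟨ coeff-+ (map (a *_) f) (0# ∷ []) k ⟩
    coeff (map (a *_) f) k + coeff (0# ∷ []) k  ≈⟨ +-cong (coeff-map (zeroʳ a) f k) (coeff-0∷[] k) ⟩
    a * coeff f k + 0#                          ≈⟨ +-identityʳ _ ⟩
    a * coeff f k                               ∎

  -- Multiplication by z shifts coefficients. The `a` term stands on the left to match the additive
  -- shape of `costep`.
  coeff-z-const-* : ∀ a f k → coeff ((z -ₚ const a) *ₚ f) k + a * coeff f k ≈ prev (coeff f) k
  coeff-z-const-* a f k = begin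
    coeff (map ((0# + - a) *_) f +ₚ (0# ∷ (const 1# *ₚ f))) k + a * coeff f k
      ≈⟨ +-congʳ (coeff-+ (map ((0# + - a) *_) f) _ k) ⟩
    coeff (map ((0# + - a) *_) f) k + coeff (0# ∷ (const 1# *ₚ f)) k + a * coeff f k
      ≈⟨ +-congʳ (+-cong (coeff-map (zeroʳ _) f k) (coeff-∷ (const 1# *ₚ f) k)) ⟩
    (0# + - a) * coeff f k + prev (coeff (const 1# *ₚ f)) k + a * coeff f k
      -- The solver is one for semirings, so `- a` enters as an independent atom and cancels only in
      -- the next step.
      ≈⟨ solve 4 (λ b a c d → (con 0 :+ b) :* c :+ d :+ a :* c := d :+ (b :+ a) :* c)
           refl (- a) a (coeff f k) _ ⟩
    prev (coeff (const 1# *ₚ f)) k + (- a + a) * coeff f k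
      ≈⟨ +-cong (prev-cong (λ k → trans (coeff-const-* 1# f k) (*-identityˡ _)) k)
                (trans (*-congʳ (-‿inverseˡ a)) (zeroˡ _)) ⟩
    prev (coeff f) k + 0#
      ≈⟨ +-identityʳ _ ⟩
    prev (coeff f) k ∎

  -- At `n = suc i` these compute to the coefficients in the last clause of `orthogonal`; the
  -- truncated `n ∸ 1` is then `i`.
  diagonal subdiagonal : (α γ : Carrier) → ℕ → Carrier
  diagonal    α γ n = α + n · γ
  subdiagonal β δ n = n · β + (n ℕ.* (n ∸ 1)) · δ

  orthogonal-recurrence : ∀ α β γ δ n k → let A = coefficientArray (orthogonal α β γ δ) in
    costep (diagonal α γ) (subdiagonal β δ) (column A k) n ≈ prev (A n) k
  orthogonal-recurrence α β γ δ zero k = begin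
    coeff (z -ₚ const α) k + (α + 0#) * coeff (const 1#) k + (0# + 0#) * 0#
      ≈⟨ solve 3 (λ a b c → a :+ (b :+ con 0) :* c :+ (con 0 :+ con 0) :* con 0 := a :+ b :* c)
           refl (coeff (z -ₚ const α) k) α (coeff (const 1#) k) ⟩
    coeff (z -ₚ const α) k + α * coeff (const 1#) k
      ≈⟨ first k ⟩
    prev (coeff (const 1#)) k ∎
    where
    first : ∀ k → coeff (z -ₚ const α) k + α * coeff (const 1#) k ≈ prev (coeff (const 1#)) k
    first zero          = trans (+-cong (+-identityˡ _) (*-identityʳ α)) (-‿inverseˡ α)
    first (suc zero)    = trans (+-congˡ (zeroʳ α)) (+-identityʳ _)
    first (suc (suc k)) = trans (+-congˡ (zeroʳ α)) (+-identityʳ _)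
  orthogonal-recurrence α β γ δ (suc n) k = begin
    coeff (F -ₚ G) k + a * coeff P₁ k + b * coeff P₀ k
      ≈⟨ +-congʳ (+-congʳ (trans (coeff-+ F (map -_ G) k)
           (+-congˡ (trans (coeff-map -0#≈0# G k) (-‿cong (coeff-const-* b P₀ k)))))) ⟩
    coeff F k - b * coeff P₀ k + a * coeff P₁ k + b * coeff P₀ k
      ≈⟨ solve 4 (λ f g h i → f :+ g :+ h :+ i := f :+ h :+ (g :+ i))
           refl (coeff F k) (- (b * coeff P₀ k)) (a * coeff P₁ k) (b * coeff P₀ k) ⟩
    coeff F k + a * coeff P₁ k + (- (b * coeff P₀ k) + b * coeff P₀ k)
      ≈⟨ +-cong (coeff-z-const-* a P₁ k) (-‿inverseˡ _) ⟩
    prev (coeff P₁) k + 0#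
      ≈⟨ +-identityʳ _ ⟩
    prev (coeff P₁) k ∎
    where
    P₀ = orthogonal α β γ δ n
    P₁ = orthogonal α β γ δ (suc n)
    a = diagonal α γ (suc n)
    b = subdiagonal β δ (suc n)
    F = (z -ₚ const a) *ₚ P₁
    G = const b *ₚ P₀

  orthogonal-base : ∀ k → coeff (const 1#) k ≈ identity 0 k
  orthogonal-base zero    = refl
  orthogonal-base (suc k) = refl

  -- Pascal's triangle.

  binomial : Matrix
  binomial n k = (n C k) · 1#

  -- Pascal's rule: the production matrix has ones on the diagonal and the superdiagonal.
  binomial-produced : ∀ n k → binomial n k ≈ produced (λ _ → 1#) (λ _ → 0#) n k
  binomial-produced = produced-unique _ _ binomial base next
    where
    base : ∀ k → binomial 0 k ≈ identity 0 k
    base zero    = +-identityʳ 1#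
    base (suc k) = ×-congˡ {1#} (k>n⇒nCk≡0 {0} {suc k} (s≤s z≤n))
    next : ∀ n k → binomial (suc n) k ≈ step (λ _ → 1#) (λ _ → 0#) (binomial n) k
    next n zero    =
      solve 1 (λ a → con 1 :+ con 0 := con 0 :+ con 1 :* (con 1 :+ con 0) :+ con 0 :* a)
        refl ((n C 1) · 1#)
    next n (suc k) = begin
      (suc n C suc k) · 1#                  ≈⟨ ×-congˡ (nCk+nC[k+1]≡[n+1]C[k+1] n k) ⟨
      (n C k ℕ.+ n C suc k) · 1#            ≈⟨ ×-homo-+ 1# (n C k) (n C suc k) ⟩
      (n C k) · 1# + (n C suc k) · 1#
        ≈⟨ solve 3 (λ a b c → a :+ b := a :+ con 1 :* b :+ con 0 :* c)
             refl ((n C k) · 1#) ((n C suc k) · 1#) ((n C suc (suc k)) · 1#) ⟩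
      (n C k) · 1# + 1# * (n C suc k) · 1# + 0# * (n C suc (suc k)) · 1# ∎

  -- Whitney numbers and the Pascal matrix in x.

  module Dowling (m x : Carrier) where

    -- Column `k` has exponential generating function `(e^(mz) - 1)^k / (m^k k!)`, that of the
    -- Whitney numbers without the factor `e^z`.
    scaledStirling : Matrix
    scaledStirling i k = S i k · (m ^ (i ∸ k))

    scaledStirling-vanishes : ∀ i k → i < k → scaledStirling i k ≈ 0#
    scaledStirling-vanishes i k i<k = ×-congˡ (S-vanishes i k i<k)

    -- Truncated subtraction lets the exponent drop by one only for `k < i`; otherwise the Stirling
    -- number is 0 and both sides vanish.
    S-raise : ∀ i k → S i (suc k) · (m ^ (i ∸ k)) ≈ m * scaledStirling i (suc k)
    S-raise i k with suc k ℕₚ.≤? i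
    ... | yes k<i = begin
      S i (suc k) · (m ^ (i ∸ k))            ≈⟨ ×-congʳ (S i (suc k)) (^-congʳ m (ℕₚ.+-∸-assoc 1 k<i)) ⟩
      S i (suc k) · (m * m ^ (i ∸ suc k))    ≈⟨ ×-comm-* (S i (suc k)) m _ ⟨
      m * scaledStirling i (suc k)           ∎
    ... | no  k≮i = begin
      S i (suc k) · (m ^ (i ∸ k))   ≈⟨ ×-congˡ (S-vanishes i (suc k) i<1+k) ⟩
      0#                            ≈⟨ zeroʳ m ⟨
      m * 0#                        ≈⟨ *-congˡ (scaledStirling-vanishes i (suc k) i<1+k) ⟨
      m * scaledStirling i (suc k)  ∎
      where i<1+k = ℕₚ.≰⇒> k≮i

    -- The Stirling recurrence, where raising the exponent contributes one factor `m` to the term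
    -- with coefficient `k`.
    scaledStirling-suc : ∀ i k →
      scaledStirling (suc i) k ≈ prev (scaledStirling i) k + (k · m) * scaledStirling i k
    scaledStirling-suc i zero    = sym (trans (+-identityˡ _) (zeroˡ _))
    scaledStirling-suc i (suc k) = begin
      (suc k ℕ.* S i (suc k) ℕ.+ S i k) · (m ^ (i ∸ k))
        ≈⟨ ×-homo-+ _ (suc k ℕ.* S i (suc k)) (S i k) ⟩
      (suc k ℕ.* S i (suc k)) · (m ^ (i ∸ k)) + scaledStirling i k
        ≈⟨ +-congʳ (×-assocˡ _ (suc k) (S i (suc k))) ⟨
      suc k · (S i (suc k) · (m ^ (i ∸ k))) + scaledStirling i k
        ≈⟨ +-congʳ (×-congʳ (suc k) (S-raise i k)) ⟩
      suc k · (m * scaledStirling i (suc k)) + scaledStirling i k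
        ≈⟨ +-congʳ (×-assoc-* (suc k) m _) ⟨
      (suc k · m) * scaledStirling i (suc k) + scaledStirling i k
        ≈⟨ +-comm _ _ ⟩
      scaledStirling i k + (suc k · m) * scaledStirling i (suc k) ∎

    whitneyDiagonal : ℕ → Carrier
    whitneyDiagonal = diagonal 1# m

    W≈binomial⊗scaledStirling : ∀ n k → W m n k ≈ (binomial ⊗ scaledStirling) n k
    W≈binomial⊗scaledStirling n k = begin
      ∑< (suc n ∸ k) (λ j → f (k ℕ.+ j))
        ≈⟨ ∑<-drop k (suc n) f (λ j j<k → ×-congˡ (≡.trans
             (≡.cong ((n C j) ℕ.*_) (S-vanishes j k j<k)) (ℕₚ.*-zeroʳ (n C j)))) ⟩
      ∑< (suc n) f
        ≈⟨ ∑<-cong (suc n) (λ j → begin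
             ((n C j) ℕ.* S j k) · (m ^ (j ∸ k))   ≈⟨ ×-assocˡ _ (n C j) (S j k) ⟨
             (n C j) · scaledStirling j k          ≈⟨ ×-congʳ (n C j) (*-identityˡ _) ⟨
             (n C j) · (1# * scaledStirling j k)   ≈⟨ ×-assoc-* (n C j) 1# _ ⟨
             (n C j) · 1# * scaledStirling j k     ∎) ⟩
      (binomial ⊗ scaledStirling) n k ∎
      where
      f = λ i → ((n C i) ℕ.* S i k) · (m ^ (i ∸ k))

    -- This amounts to `W(n+1,k) = W(n,k-1) + (1 + k m) W(n,k)`: the Pascal factor adds 1 to the
    -- diagonal entries `k m` of the Stirling factor.
    W-produced : ∀ n k → W m n k ≈ produced whitneyDiagonal (λ _ → 0#) n k
    W-produced n k = begin
      W m n k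
        ≈⟨ W≈binomial⊗scaledStirling n k ⟩
      (binomial ⊗ scaledStirling) n k
        ≈⟨ ⊗-congʳ scaledStirling binomial-produced n k ⟩
      (produced (λ _ → 1#) (λ _ → 0#) ⊗ scaledStirling) n k
        ≈⟨ produced-⊗ _ _ _ _ scaledStirling base commutes n k ⟩
      produced whitneyDiagonal (λ _ → 0#) n k ∎
      where
      base : ∀ k → scaledStirling 0 k ≈ identity 0 k
      base zero    = +-identityʳ 1#
      base (suc k) = refl
      commutes : ∀ i k → costep (λ _ → 1#) (λ _ → 0#) (column scaledStirling k) i
                       ≈ step whitneyDiagonal (λ _ → 0#) (scaledStirling i) k
      commutes i k = trans (+-congʳ (+-congʳ (scaledStirling-suc i k)))
        (solve 5 (λ t₀ t a u v →
             t₀ :+ a :* t :+ con 1 :* t :+ con 0 :* u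
           := t₀ :+ (con 1 :+ a) :* t :+ con 0 :* v)
           refl (prev (scaledStirling i) k) (scaledStirling i k) (k · m)
             (prev (column scaledStirling k) i) (scaledStirling i (suc k)))

    -- The entries are (j C k) x^(j-k).
    pascal : Matrix
    pascal = produced (λ _ → x) (λ _ → 0#)

    pascal-column₀ : ∀ j → pascal j 0 ≈ x ^ j
    pascal-column₀ zero    = refl
    pascal-column₀ (suc j) = trans
      (solve 3 (λ x a b → con 0 :+ x :* a :+ con 0 :* b := x :* a) refl x (pascal j 0) (pascal j 1))
      (*-congˡ (pascal-column₀ j))

    -- This is m times (j - k) (j C k) x^(j-k) = (k + 1) (j C k+1) x^(j-k).
    pascal-weight : ∀ j k →
      (j · m) * pascal j k ≈ (k · m) * pascal j k + (suc k · m) * x * pascal j (suc k)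
    pascal-weight zero    zero    =
      solve 2 (λ m x → con 0 :* con 1 := con 0 :* con 1 :+ (m :+ con 0) :* x :* con 0) refl m x
    pascal-weight zero    (suc k) =
      solve 3 (λ a b x → con 0 :* con 0 := a :* con 0 :+ b :* x :* con 0) refl _ _ x
    pascal-weight (suc j) zero    = begin
      (m + J) * (0# + x * X₀ + 0# * X₁)
        ≈⟨ solve 5 (λ m J x X₀ X₁ →
               (m :+ J) :* (con 0 :+ x :* X₀ :+ con 0 :* X₁) := m :* x :* X₀ :+ x :* (J :* X₀))
             refl m J x X₀ X₁ ⟩
      m * x * X₀ + x * (J * X₀)
        ≈⟨ +-congˡ (*-congˡ (pascal-weight j 0)) ⟩
      m * x * X₀ + x * (0# * X₀ + (m + 0#) * x * X₁)
        ≈⟨ solve 5 (λ m x X₀ X₁ X₂ →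
               m :* x :* X₀ :+ x :* (con 0 :* X₀ :+ (m :+ con 0) :* x :* X₁)
             := con 0 :* (con 0 :+ x :* X₀ :+ con 0 :* X₁)
                :+ (m :+ con 0) :* x :* (X₀ :+ x :* X₁ :+ con 0 :* X₂))
             refl m x X₀ X₁ (pascal j 2) ⟩
      0# * (0# + x * X₀ + 0# * X₁) + (m + 0#) * x * (X₀ + x * X₁ + 0# * pascal j 2) ∎
      where
      J = j · m
      X₀ = pascal j 0
      X₁ = pascal j 1
    pascal-weight (suc j) (suc k) = begin
      (m + J) * (X₀ + x * X₁ + 0# * X₂)
        -- Expanding exposes `J * X₀` and `J * X₁`, to which the induction hypotheses at columns `k`
        -- and `k + 1` apply.
        ≈⟨ solve 6 (λ m J x X₀ X₁ X₂ →
               (m :+ J) :* (X₀ :+ x :* X₁ :+ con 0 :* X₂)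
             := m :* X₀ :+ m :* x :* X₁ :+ (J :* X₀ :+ x :* (J :* X₁)))
             refl m J x X₀ X₁ X₂ ⟩
      m * X₀ + m * x * X₁ + (J * X₀ + x * (J * X₁))
        ≈⟨ +-congˡ (+-cong (pascal-weight j k) (*-congˡ (pascal-weight j (suc k)))) ⟩
      m * X₀ + m * x * X₁ +
        ((K * X₀ + (m + K) * x * X₁) + x * ((m + K) * X₁ + (m + (m + K)) * x * X₂))
        ≈⟨ solve 7 (λ m K x X₀ X₁ X₂ X₃ →
               m :* X₀ :+ m :* x :* X₁ :+
                 ((K :* X₀ :+ (m :+ K) :* x :* X₁)
                  :+ x :* ((m :+ K) :* X₁ :+ (m :+ (m :+ K)) :* x :* X₂))
             := (m :+ K) :* (X₀ :+ x :* X₁ :+ con 0 :* X₂)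
                :+ (m :+ (m :+ K)) :* x :* (X₁ :+ x :* X₂ :+ con 0 :* X₃))
             refl m K x X₀ X₁ X₂ X₃ ⟩
      (m + K) * (X₀ + x * X₁ + 0# * X₂) + (m + (m + K)) * x * (X₁ + x * X₂ + 0# * X₃) ∎
      where
      J = j · m
      K = k · m
      X₀ = pascal j k
      X₁ = pascal j (suc k)
      X₂ = pascal j (suc (suc k))
      X₃ = pascal j (suc (suc (suc k)))

    -- The recurrence coefficients, and the Dowling polynomials as moments.

    α β γ δ : Carrier
    α = 1# + x
    β = m * x
    γ = m
    δ = 0#

    subdiagonal-β : ∀ k → subdiagonal β δ k ≈ (k · m) * x
    subdiagonal-β k = begin
      k · (m * x) + (k ℕ.* (k ∸ 1)) · 0#  ≈⟨ +-cong (sym (×-assoc-* k m x)) (·-zero (k ℕ.* (k ∸ 1))) ⟩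
      (k · m) * x + 0#                    ≈⟨ +-identityʳ _ ⟩
      (k · m) * x                         ∎
      where
      ·-zero : ∀ n → n · 0# ≈ 0#
      ·-zero zero    = refl
      ·-zero (suc n) = trans (+-identityˡ _) (·-zero n)

    -- `pascal-weight` trades the row weight `j m` for column weights: `k m` joins the diagonal
    -- `1 + x`, and `(k + 1) m x` becomes the subdiagonal entry, whence `γ = m` and `β = m x`.
    pascal-commutes : ∀ j k → costep whitneyDiagonal (λ _ → 0#) (column pascal k) j
                            ≈ step (diagonal α γ) (subdiagonal β δ) (pascal j) k
    pascal-commutes j k = begin
      (X₀ + x * X + 0# * X′) + (1# + j · m) * X + 0# * prev (column pascal k) j
        ≈⟨ solve 6 (λ x J X₀ X X′ u →
               (X₀ :+ x :* X :+ con 0 :* X′) :+ (con 1 :+ J) :* X :+ con 0 :* u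
             := X₀ :+ (con 1 :+ x) :* X :+ J :* X)
             refl x (j · m) X₀ X X′ (prev (column pascal k) j) ⟩
      X₀ + (1# + x) * X + (j · m) * X
        ≈⟨ +-congˡ (pascal-weight j k) ⟩
      X₀ + (1# + x) * X + ((k · m) * X + (suc k · m) * x * X′)
        ≈⟨ +-congˡ (+-congˡ (*-congʳ (subdiagonal-β (suc k)))) ⟨
      X₀ + (1# + x) * X + ((k · m) * X + subdiagonal β δ (suc k) * X′)
        ≈⟨ solve 6 (λ a K X₀ X X′ q →
               X₀ :+ a :* X :+ (K :* X :+ q :* X′) := X₀ :+ (a :+ K) :* X :+ q :* X′)
             refl (1# + x) (k · m) X₀ X X′ (subdiagonal β δ (suc k)) ⟩
      X₀ + (1# + x + k · m) * X + subdiagonal β δ (suc k) * X′ ∎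
      where
      X₀ = prev (pascal j) k
      X = pascal j k
      X′ = pascal j (suc k)

    D-produced : ∀ n → D m n x ≈ produced (diagonal α γ) (subdiagonal β δ) n 0
    D-produced n = begin
      ∑< (suc n) (λ k → W m n k * x ^ k)
        ≈⟨ ∑<-cong (suc n) (λ k → *-cong (W-produced n k) (sym (pascal-column₀ k))) ⟩
      (produced whitneyDiagonal (λ _ → 0#) ⊗ pascal) n 0
        ≈⟨ produced-⊗ _ _ _ _ pascal (λ _ → refl) pascal-commutes n 0 ⟩
      produced (diagonal α γ) (subdiagonal β δ) n 0 ∎

    D-moments : AreMomentsOf (λ n → D m n x) (orthogonal α β γ δ)
    D-moments = produced (diagonal α γ) (subdiagonal β δ)
      , Inverse.isInverse _ _ _ orthogonal-base (orthogonal-recurrence α β γ δ)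
      , D-produced

proposition3 : ∀ {c ℓ} (R : CommutativeRing c ℓ) →
    let open CommutativeRing R using (Carrier)
        open Moments R
    in (m x : Carrier) →
       ∃ λ α → ∃ λ β → ∃ λ γ → ∃ λ δ →
         AreMomentsOf (λ n → D m n x) (orthogonal α β γ δ)
proposition3 R m x = α , β , γ , δ , D-moments
  where open Production.Dowling R m x
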